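{- For every integer $e\geq 3$ there exists an integer $M$ such that $\mathscr{R}(e,m)<\mathscr{C}(e,m)$ for all integers $m\geq M$.
   Context: A numerical monoid is an additive submonoid $\Gamma\subseteq\mathbb{N}$ (containing $0$) with $\mathbb{N}\setminus\Gamma$ finite. It has a unique minimal set of generators $g_0<g_1<\cdots<g_e$; its embedding dimension is $\mathrm{edim}(\Gamma)=e+1$ and its multiplicity is $\mathrm{mult}(\Gamma)=g_0$. Let $\varphi:\mathbb{N}^{e+1}\to\mathbb{N}$, $\varphi(a_0,\dots,a_e)=\sum_i a_ig_i$, and let $\ker\varphi=\{(\mathbf a,\mathbf b): \varphi(\mathbf a)=\varphi(\mathbf b)\}$ (a congruence on $\mathbb{N}^{e+1}$). The number of minimal relations $\rho(\Gamma)$ is the cardinality of a minimal generating set of the congruence $\ker\varphi$ (independent of the choice). Define $\mathscr{R}(e,m)=\max\{\rho(\Gamma): \mathrm{edim}(\Gamma)=e+1,\ \mathrm{mult}(\Gamma)=m\}$. For positive integers $n,d$ write the Macaulay expansion $n=\binom{n_d}{d}+\cdots+\binom{n_j}{j}$ with uniquely determined integers $n_d>n_{d-1}>\cdots>n_j\geq j\geq 1$, and set $n^{\langle d\rangle}=\binom{n_d+1}{d+1}+\cdots+\binom{n_j+1}{j+1}$; set $0^{\langle d\rangle}=0$. For integers $1<e<m$, let $r$ be the unique integer with $\binom{e+r-1}{r-1}\leq m<\binom{e+r}{r}$, let $s=m-\binom{e+r-1}{r-1}$, and define $\mathscr{C}(e,m)=\binom{e+r-1}{r}+s^{\langle r\rangle}-s$.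 -}

module Defs where

open import Data.Nat using (ℕ; zero; suc; _+_; _*_; _∸_; _≤_; _<_; _<ᵇ_; _≤ᵇ_)
open import Data.Nat.Combinatorics using (_C_)
open import Data.Bool using (if_then_else_)
open import Data.Fin using (Fin) renaming (_<_ to _<ᶠ_)
open import Data.Vec using (Vec; lookup; zipWith; replicate)
open import Data.List using (List; length)
import Data.Nat.ListAction
open import Data.List.Membership.Propositional using (_∈_)
open import Data.Product using (_×_; _,_; ∃; ∃-syntax; Σ)
open import Relation.Binary.PropositionalEquality using (_≡_)
open import Function.Bundles using (_⇔_)

φ : ∀ {k} → Vec ℕ k → Vec ℕ k → ℕ
φ g a = Data.Nat.ListAction.sum (Data.Vec.toList (zipWith _*_ a g))

InMonoid : ∀ {k} → Vec ℕ k → ℕ → Set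
InMonoid {k} g n = ∃[ a ] φ {k} g a ≡ n

StrictlyIncreasing : ∀ {k} → Vec ℕ k → Set
StrictlyIncreasing g = ∀ i j → i <ᶠ j → lookup g i < lookup g j

Minimal : ∀ {k} → Vec ℕ k → Set
Minimal {k} g = ∀ i → (a : Vec ℕ k) → lookup a i ≡ 0 → φ g a ≡ lookup g i → Data.Empty.⊥
  where import Data.Empty

Cofinite : ∀ {k} → Vec ℕ k → Set
Cofinite g = ∃[ F ] (∀ n → F ≤ n → InMonoid g n)

-- g = (g₀,…,g_e) is the minimal generating system of a numerical monoid Γ
-- (so edim Γ = e+1 and mult Γ = g₀)
IsNumMonoidMinGens : ∀ {k} → Vec ℕ k → Set
IsNumMonoidMinGens g = StrictlyIncreasing g × Minimal g × Cofinite g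

_⊕_ : ∀ {k} → Vec ℕ k → Vec ℕ k → Vec ℕ k
a ⊕ b = zipWith _+_ a b

data CongClosure {k} (ρs : List (Vec ℕ k × Vec ℕ k)) : Vec ℕ k → Vec ℕ k → Set where
  base  : ∀ {a b} → (a , b) ∈ ρs → CongClosure ρs a b
  refl  : ∀ {a} → CongClosure ρs a a
  sym   : ∀ {a b} → CongClosure ρs a b → CongClosure ρs b a
  trans : ∀ {a b c} → CongClosure ρs a b → CongClosure ρs b c → CongClosure ρs a c
  plus  : ∀ {a b c d} → CongClosure ρs a b → CongClosure ρs c d →
          CongClosure ρs (a ⊕ c) (b ⊕ d)

GeneratesKer : ∀ {k} → Vec ℕ k → List (Vec ℕ k × Vec ℕ k) → Set
GeneratesKer g ρs = ∀ a b → (φ g a ≡ φ g b) ⇔ CongClosure ρs a b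

-- n = ρ(Γ): the cardinality of a minimal generating set of ker φ
-- (= least cardinality of a generating set)
IsRho : ∀ {k} → Vec ℕ k → ℕ → Set
IsRho g n =
  (∃[ ρs ] (GeneratesKer g ρs × length ρs ≡ n)) ×
  (∀ ρs → GeneratesKer g ρs → n ≤ length ρs)

-- Macaulay upper function n^⟨d⟩ (greedy Macaulay expansion)

largestK : ℕ → ℕ → ℕ → ℕ
largestK n d zero    = 0
largestK n d (suc b) = if (suc b) C d ≤ᵇ n then suc b else largestK n d b

macUp : ℕ → ℕ → ℕ
macUp d       zero    = 0
macUp zero    (suc n) = 0   -- not used (d ≥ 1 in the paper)
macUp (suc d) (suc n) =
  let k = largestK (suc n) (suc d) (suc n + suc d) in
  (suc k C suc (suc d)) + macUp d (suc n ∸ (k C suc d))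

findR : ℕ → ℕ → ℕ → ℕ → ℕ
findR e m zero     r = r
findR e m (suc f)  r = if m <ᵇ ((e + r) C r) then r else findR e m f (suc r)

-- the unique r with C(e+r-1, r-1) ≤ m < C(e+r, r)   (for m ≥ 1)
rOf : ℕ → ℕ → ℕ
rOf e m = findR e m m 1

sOf : ℕ → ℕ → ℕ
sOf e m = m ∸ ((e + (rOf e m ∸ 1)) C (rOf e m ∸ 1))

𝒞 : ℕ → ℕ → ℕ
𝒞 e m = ((e + (r ∸ 1)) C r) + macUp r s ∸ s
  where
    r = rOf e m
    s = sOf e m

{-# OPTIONS --safe #-}
-- Write e + 1 for the embedding dimension and order the exponents of
-- g₁, …, g_e by weight, ties broken lexicographically.  The exponents that
-- are not smallest in their residue class modulo m form a monomial ideal, and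
-- rewriting each of its minimal generators ("corners") to the smallest
-- exponent of its class presents ker φ; so ρ is at most the number of corners.
--
-- A corner and the exponent it rewrites to have no variable in common, for
-- cancelling one would leave a smaller reducible exponent.  So a corner of
-- full support is congruent to 0, and there is at most one of those.  If a is
-- a corner with aᵢ ≥ t, the exponents a - j eᵢ for 1 ≤ j ≤ t are irreducible,
-- and for fixed i they have distinct residues as a and j vary, so at most
-- e m / t corners have an entry ≥ t.  The remaining corners have a zero entry
-- and all entries below t; being an antichain, they number at most e t^(e-2).
-- For t = 2 (e + r) the total is below C(e+r-1, r) ≤ 𝒞 e m once r is large.
module Submission where

open import Defs hiding (refl; sym; trans)
open import Algebra.Properties.CommutativeSemigroup using (interchange; x∙yz≈y∙xz)
open import Data.Bool using (true; false; T)
open import Data.Fin using (Fin; zero; suc)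
import Data.Fin.Properties as Fin
open import Data.List as List using (List; []; _∷_; length; upTo; filter; cartesianProduct; cartesianProductWith; allFin; map)
open import Data.List.Membership.Propositional using (_∈_; lose)
open import Data.List.Membership.Propositional.Properties
open import Data.List.Properties using (length-upTo; length-++; length-map; length-tabulate)
import Data.List.Relation.Unary.All as All
open import Data.List.Relation.Unary.AllPairs using ([]; _∷_)
open import Data.List.Relation.Unary.All using ([])
open import Data.List.Relation.Unary.Any using (here; there; index; any?; satisfied)
import Data.List.Relation.Unary.Any.Properties as Any
open import Data.List.Relation.Unary.Unique.Propositional using (Unique)
import Data.List.Relation.Unary.Unique.Propositional.Properties as Unique
open import Data.Nat using (ℕ; zero; suc; _+_; _*_; _∸_; _^_; _!; _≤_; _<_; z≤n; s≤s; NonZero; >-nonZero; _≤?_; _<?_; _≟_; _<ᵇ_; _≤ᵇ_)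
open import Data.Nat.Combinatorics using (_C_; nCn≡1; nC1≡n; nCk+nC[k+1]≡[n+1]C[k+1])
open import Data.Nat.DivMod using (_%_; _/_; m≡m%n+[m/n]*n; m%n<n; [m+kn]%n≡m%n; %-distribˡ-+; %-congˡ; /-monoˡ-≤)
open import Data.Nat.Induction using (<-wellFounded)
open import Data.Nat.Properties hiding (_≤?_; _<?_; _≟_)
open import Data.Nat.Tactic.RingSolver using (solve-∀)
open import Data.Product using (_×_; _,_; ∃-syntax; proj₁; proj₂)
open import Data.Product.Properties using (,-injective)
open import Data.Sum using (_⊎_; inj₁; inj₂)
open import Data.Unit using (tt)
open import Data.Vec using (Vec; []; _∷_; lookup; replicate; zipWith; removeAt; insertAt; tail)
open import Data.Vec.Properties using (zipWith-comm; zipWith-assoc; zipWith-identityˡ; lookup-zipWith; ∷-injective; ∷-injectiveʳ; insertAt-removeAt)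
open import Data.Vec.Relation.Binary.Lex.Strict as Lex using (Lex-<; this; next)
open import Data.Vec.Relation.Binary.Pointwise.Inductive using (Pointwise-≡⇒≡; ≡⇒Pointwise-≡)
open import Function using (mk⇔)
open import Induction.WellFounded using (WellFounded; Acc; acc)
open import Relation.Binary using (tri<; tri≈; tri>)
import Relation.Binary.Construct.On as On
open import Relation.Binary.PropositionalEquality using (_≡_; _≢_; refl; sym; trans; cong; cong₂; subst; subst₂; module ≡-Reasoning)
open import Relation.Nullary using (¬_; Dec; yes; no; contradiction)
open import Relation.Nullary.Decidable using (map′; _×-dec_; _→-dec_)
open import Relation.Unary using (Decidable)

-- Counting with lists

lookup-injective : ∀ {A : Set} {xs : List A} → Unique xs → ∀ i j → List.lookup xs i ≡ List.lookup xs j → i ≡ j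
lookup-injective (_ ∷ _)   zero    zero    _  = refl
lookup-injective (x∉ ∷ _)  zero    (suc j) eq = contradiction eq (All.lookup x∉ (∈-lookup j))
lookup-injective (x∉ ∷ _)  (suc i) zero    eq = contradiction (sym eq) (All.lookup x∉ (∈-lookup i))
lookup-injective (_ ∷ xs!) (suc i) (suc j) eq = cong suc (lookup-injective xs! i j eq)

-- Injectivity is asked for on the entries of `xs` only: the counting maps below are shown to be
-- injective just on corners.
length-≤-injection : ∀ {A B : Set} {xs : List A} {ys : List B} (f : A → B) → Unique xs →
  (∀ {x y} → x ∈ xs → y ∈ xs → f x ≡ f y → x ≡ y) → (∀ {x} → x ∈ xs → f x ∈ ys) →
  length xs ≤ length ys
length-≤-injection {xs = xs} {ys} f xs! inj into = Fin.injective⇒≤ {f = pos} pos-injective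
  where
  pos : Fin (length xs) → Fin (length ys)
  pos i = index (into (∈-lookup i))

  at-pos : ∀ i → f (List.lookup xs i) ≡ List.lookup ys (pos i)
  at-pos i = Any.lookup-index (into (∈-lookup i))

  pos-injective : ∀ {i j} → pos i ≡ pos j → i ≡ j
  pos-injective {i} {j} eq = lookup-injective xs! i j (inj (∈-lookup i) (∈-lookup j)
    (trans (at-pos i) (trans (cong (List.lookup ys) eq) (sym (at-pos j)))))

length-filter-cover : ∀ {A : Set} {P Q : A → Set} (P? : Decidable P) (Q? : Decidable Q) (xs : List A) →
  (∀ {x} → x ∈ xs → P x ⊎ Q x) → length xs ≤ length (filter P? xs) + length (filter Q? xs)
length-filter-cover P? Q? []       _     = z≤n
length-filter-cover P? Q? (x ∷ xs) cover with P? x | Q? x | length-filter-cover P? Q? xs (λ x∈ → cover (there x∈))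
... | yes _ | yes _ | ih = s≤s (≤-trans ih (+-monoʳ-≤ (length (filter P? xs)) (n≤1+n _)))
... | yes _ | no _  | ih = s≤s ih
... | no _  | yes _ | ih = ≤-trans (s≤s ih) (≤-reflexive (sym (+-suc _ _)))
... | no ¬p | no ¬q | _ with cover (here refl)
...   | inj₁ p = contradiction p ¬p
...   | inj₂ q = contradiction q ¬q

length-cartesianProductWith : ∀ {A B C : Set} (f : A → B → C) (xs : List A) (ys : List B) →
  length (cartesianProductWith f xs ys) ≡ length xs * length ys
length-cartesianProductWith f []       ys = refl
length-cartesianProductWith f (x ∷ xs) ys = trans (length-++ (map (f x) ys))
  (cong₂ _+_ (length-map (f x) ys) (length-cartesianProductWith f xs ys))

box : ℕ → ∀ n → List (Vec ℕ n)
box k zero    = [] ∷ []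
box k (suc n) = cartesianProductWith _∷_ (upTo k) (box k n)

length-box : ∀ k n → length (box k n) ≡ k ^ n
length-box k zero    = refl
length-box k (suc n) = trans (length-cartesianProductWith _∷_ (upTo k) (box k n))
  (cong₂ _*_ (length-upTo k) (length-box k n))

box-unique : ∀ k n → Unique (box k n)
box-unique k zero    = [] ∷ []
box-unique k (suc n) = Unique.cartesianProductWith⁺ _∷_ ∷-injective (Unique.upTo⁺ k) (box-unique k n)

∈-box : ∀ {k n} (a : Vec ℕ n) → (∀ i → lookup a i < k) → a ∈ box k n
∈-box []      _ = here refl
∈-box (x ∷ a) b = ∈-cartesianProductWith⁺ _∷_ (∈-upTo⁺ (b zero)) (∈-box a (λ i → b (suc i)))

-- Exponent vectors

𝟘 : ∀ {n} → Vec ℕ n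
𝟘 = replicate _ 0

⊕-comm : ∀ {n} (a b : Vec ℕ n) → a ⊕ b ≡ b ⊕ a
⊕-comm = zipWith-comm +-comm

⊕-assoc : ∀ {n} (a b c : Vec ℕ n) → (a ⊕ b) ⊕ c ≡ a ⊕ (b ⊕ c)
⊕-assoc = zipWith-assoc +-assoc

𝟘-⊕ : ∀ {n} (a : Vec ℕ n) → 𝟘 ⊕ a ≡ a
𝟘-⊕ = zipWith-identityˡ +-identityˡ

⊕-cancelˡ : ∀ {n} (c : Vec ℕ n) {a b} → c ⊕ a ≡ c ⊕ b → a ≡ b
⊕-cancelˡ []      {[]}    {[]}    _  = refl
⊕-cancelˡ (z ∷ c) {x ∷ a} {y ∷ b} eq =
  cong₂ _∷_ (+-cancelˡ-≡ z x y (proj₁ (∷-injective eq))) (⊕-cancelˡ c (proj₂ (∷-injective eq)))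

single : ∀ {n} → Fin n → ℕ → Vec ℕ n
single zero    j = j ∷ 𝟘
single (suc i) j = 0 ∷ single i j

single-+ : ∀ {n} (i : Fin n) j k → single i (j + k) ≡ single i j ⊕ single i k
single-+ zero    j k = cong (j + k ∷_) (sym (𝟘-⊕ 𝟘))
single-+ (suc i) j k = cong (0 ∷_) (single-+ i j k)

lookup-single : ∀ {n} (i : Fin n) j → lookup (single i j) i ≡ j
lookup-single zero    j = refl
lookup-single (suc i) j = lookup-single i j

single-injective : ∀ {n} (i : Fin n) {j k} → single i j ≡ single i k → j ≡ k
single-injective i {j} {k} eq =
  trans (sym (lookup-single i j)) (trans (cong (λ v → lookup v i) eq) (lookup-single i k))

-- Truncated subtraction is a true difference only where the subtrahend fits. Where `lookup a i` is
-- 0, `a ⊖ single i 1` is `a` itself.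
_⊖_ : ∀ {n} → Vec ℕ n → Vec ℕ n → Vec ℕ n
a ⊖ b = zipWith _∸_ a b

𝟘-⊖ : ∀ {n} (a : Vec ℕ n) → a ⊖ 𝟘 ≡ a
𝟘-⊖ []      = refl
𝟘-⊖ (x ∷ a) = cong (x ∷_) (𝟘-⊖ a)

single-⊕-⊖ : ∀ {n} (i : Fin n) (a : Vec ℕ n) {j} → j ≤ lookup a i → single i j ⊕ (a ⊖ single i j) ≡ a
single-⊕-⊖ zero    (x ∷ a) j≤x = cong₂ _∷_ (m+[n∸m]≡n j≤x) (trans (𝟘-⊕ _) (𝟘-⊖ a))
single-⊕-⊖ (suc i) (x ∷ a) j≤x = cong (x ∷_) (single-⊕-⊖ i a j≤x)

zero-or-positive : ∀ {n} (a : Vec ℕ n) → a ≡ 𝟘 ⊎ ∃[ i ] 1 ≤ lookup a i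
zero-or-positive []          = inj₁ refl
zero-or-positive (suc x ∷ a) = inj₂ (zero , s≤s z≤n)
zero-or-positive (zero ∷ a) with zero-or-positive a
... | inj₁ refl      = inj₁ refl
... | inj₂ (i , 1≤) = inj₂ (suc i , 1≤)

insertAt-⊕ : ∀ {n} (a b : Vec ℕ n) (i : Fin (suc n)) → insertAt (a ⊕ b) i 0 ≡ insertAt a i 0 ⊕ insertAt b i 0
insertAt-⊕ a       b       zero    = refl
insertAt-⊕ (x ∷ a) (y ∷ b) (suc i) = cong (x + y ∷_) (insertAt-⊕ a b i)

lookup-removeAt : ∀ {n} (a : Vec ℕ (suc n)) i j → ∃[ k ] lookup (removeAt a i) j ≡ lookup a k
lookup-removeAt (x ∷ a)         zero    j       = suc j , refl
lookup-removeAt (x ∷ y ∷ a)     (suc i) zero    = zero , refl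
lookup-removeAt (x ∷ y ∷ a)     (suc i) (suc j) with lookup-removeAt (y ∷ a) i j
... | k , eq = suc k , eq

φ-⊕ : ∀ {n} (g a b : Vec ℕ n) → φ g (a ⊕ b) ≡ φ g a + φ g b
φ-⊕ []      []      []      = refl
φ-⊕ (z ∷ g) (x ∷ a) (y ∷ b) = begin
  (x + y) * z + φ g (a ⊕ b)         ≡⟨ cong₂ _+_ (*-distribʳ-+ z x y) (φ-⊕ g a b) ⟩
  (x * z + y * z) + (φ g a + φ g b) ≡⟨ interchange +-commutativeSemigroup (x * z) (y * z) (φ g a) (φ g b) ⟩
  (x * z + φ g a) + (y * z + φ g b) ∎
  where open ≡-Reasoning

φ-𝟘 : ∀ {n} (g : Vec ℕ n) → φ g 𝟘 ≡ 0
φ-𝟘 []      = refl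
φ-𝟘 (z ∷ g) = φ-𝟘 g

lookup≤φ : ∀ {n} (g : Vec ℕ n) → (∀ i → 1 ≤ lookup g i) → ∀ a i → lookup a i ≤ φ g a
lookup≤φ (z ∷ g) pos (x ∷ a) zero    = ≤-trans (m≤m*n x z {{>-nonZero (pos zero)}}) (m≤m+n _ _)
lookup≤φ (z ∷ g) pos (x ∷ a) (suc i) = ≤-trans (lookup≤φ g (λ i → pos (suc i)) a i) (m≤n+m _ _)

-- the witness is unspecified (0) when no entry satisfies P
pick : ∀ {n} {P : ℕ → Set} → Decidable P → Vec ℕ (suc n) → Fin (suc n)
pick P? a with Fin.any? (λ i → P? (lookup a i))
... | yes (i , _) = i
... | no _        = zero

pick-satisfies : ∀ {n} {P : ℕ → Set} (P? : Decidable P) (a : Vec ℕ (suc n)) →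
  ∃[ i ] P (lookup a i) → P (lookup a (pick P? a))
pick-satisfies P? a ∃p with Fin.any? (λ i → P? (lookup a i))
... | yes (_ , p) = p
... | no ¬∃p      = contradiction ∃p ¬∃p

-- The monomial ideal of reducible exponents

+-congˡ-% : ∀ m .{{_ : NonZero m}} z {x y} → x % m ≡ y % m → (z + x) % m ≡ (z + y) % m
+-congˡ-% m z {x} {y} eq = begin
  (z + x) % m           ≡⟨ %-distribˡ-+ z x m ⟩
  (z % m + x % m) % m   ≡⟨ cong (λ r → (z % m + r) % m) eq ⟩
  (z % m + y % m) % m   ≡⟨ %-distribˡ-+ z y m ⟨
  (z + y) % m           ∎
  where open ≡-Reasoning

+-cancelˡ-% : ∀ m .{{_ : NonZero m}} z {x y} → (z + x) % m ≡ (z + y) % m → x % m ≡ y % m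
+-cancelˡ-% m@(suc m′) z {x} {y} eq =
  trans (sym (complement x)) (trans (+-congˡ-% m (z * m′) eq) (complement y))
  where
  open ≡-Reasoning
  -- With `m = suc m′`, the number `z * m′` acts as the negative of `z` modulo `m`, since
  -- `z * m′ + z` is `z * m`.
  complement : ∀ x → (z * m′ + (z + x)) % m ≡ x % m
  complement x = begin
    (z * m′ + (z + x)) % m ≡⟨ cong (_% m) (+-assoc (z * m′) z x) ⟨
    (z * m′ + z + x) % m   ≡⟨ cong (λ t → (t + x) % m) (trans (+-comm (z * m′) z) (sym (*-suc z m′))) ⟩
    (z * m + x) % m        ≡⟨ cong (_% m) (+-comm (z * m) x) ⟩
    (x + z * m) % m        ≡⟨ [m+kn]%n≡m%n x z m ⟩
    x % m                  ∎

infix 4 _<ˡ_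
_<ˡ_ : ∀ {n} → Vec ℕ n → Vec ℕ n → Set
_<ˡ_ = Lex-< _≡_ _<_

⊕-monoʳ-<ˡ : ∀ {n} (c : Vec ℕ n) {a b} → a <ˡ b → c ⊕ a <ˡ c ⊕ b
⊕-monoʳ-<ˡ []      {[]}    {[]}    a<b           = a<b
⊕-monoʳ-<ˡ (z ∷ c) {_ ∷ _} {_ ∷ _} (this x<y _)  = this (+-monoʳ-< z x<y) refl
⊕-monoʳ-<ˡ (z ∷ c) {_ ∷ _} {_ ∷ _} (next eq a<b) = next (cong (z +_) eq) (⊕-monoʳ-<ˡ c a<b)

-- Here `e` is `2 + k`: the entries of `gs` play the role of g₁, ..., g_e, and `m` that of g₀.
-- Exponents have no coordinate for `m`, which enters only as a modulus until relations are built.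
module _ {k} (m : ℕ) .{{_ : NonZero m}} (gs : Vec ℕ (suc (suc k))) (gs>0 : ∀ i → 1 ≤ lookup gs i) where

  Exponent : Set
  Exponent = Vec ℕ (suc (suc k))

  -- With the weight as leading coordinate, comparing by weight and then lexicographically is a
  -- plain lexicographic comparison, which is well-founded, total and translation invariant.
  weighted : Exponent → Vec ℕ (3 + k)
  weighted a = φ gs a ∷ a

  infix 4 _≺_ _≈_
  _≺_ _≈_ : Exponent → Exponent → Set
  a ≺ b = weighted a <ˡ weighted b
  a ≈ b = φ gs a % m ≡ φ gs b % m

  ≺-wellFounded : WellFounded _≺_
  ≺-wellFounded = On.wellFounded weighted
    (Lex.<-wellFounded trans (λ { refl x<y → x<y }) <-wellFounded)

  ≺⇒φ≤φ : ∀ {a b} → a ≺ b → φ gs a ≤ φ gs b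
  ≺⇒φ≤φ (this a<b _) = <⇒≤ a<b
  ≺⇒φ≤φ (next a≡b _) = ≤-reflexive a≡b

  ≺-⊕ : ∀ c {a b} → a ≺ b → c ⊕ a ≺ c ⊕ b
  ≺-⊕ c {a} {b} a≺b =
    subst (_<ˡ weighted (c ⊕ b)) (cong (_∷ (c ⊕ a)) (sym (φ-⊕ gs c a)))
      (subst ((φ gs c + φ gs a ∷ (c ⊕ a)) <ˡ_) (cong (_∷ (c ⊕ b)) (sym (φ-⊕ gs c b)))
        (⊕-monoʳ-<ˡ (weighted c) a≺b))

  ≺-total : ∀ a b → a ≺ b ⊎ a ≡ b ⊎ b ≺ a
  ≺-total a b with Lex.<-cmp sym <-cmp (weighted a) (weighted b)
  ... | tri< a≺b _ _ = inj₁ a≺b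
  ... | tri≈ _ eq _  = inj₂ (inj₁ (∷-injectiveʳ (Pointwise-≡⇒≡ eq)))
  ... | tri> _ _ b≺a = inj₂ (inj₂ b≺a)

  ≺-irrefl : ∀ {a} → ¬ a ≺ a
  ≺-irrefl = Lex.<-irrefl <-irrefl (≡⇒Pointwise-≡ refl)

  ≺-asym : ∀ {a b} → a ≺ b → ¬ b ≺ a
  ≺-asym = Lex.<-asym sym <-resp₂-≡ <-asym

  ≺-cancel-⊕ : ∀ c {a b} → c ⊕ a ≺ c ⊕ b → a ≺ b
  ≺-cancel-⊕ c {a} {b} lt with ≺-total a b
  ... | inj₁ a≺b         = a≺b
  ... | inj₂ (inj₁ refl) = contradiction lt ≺-irrefl
  ... | inj₂ (inj₂ b≺a)  = contradiction (≺-⊕ c b≺a) (≺-asym lt)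

  ≈-⊕ : ∀ c {a b} → a ≈ b → c ⊕ a ≈ c ⊕ b
  ≈-⊕ c {a} {b} a≈b = trans (%-congˡ {o = m} (φ-⊕ gs c a))
    (trans (+-congˡ-% m (φ gs c) a≈b) (%-congˡ {o = m} (sym (φ-⊕ gs c b))))

  ≈-cancel-⊕ : ∀ c {a b} → c ⊕ a ≈ c ⊕ b → a ≈ b
  ≈-cancel-⊕ c {a} {b} eq = +-cancelˡ-% m (φ gs c)
    (trans (%-congˡ {o = m} (sym (φ-⊕ gs c a))) (trans eq (%-congˡ {o = m} (φ-⊕ gs c b))))

  -- The weights of the irreducible exponents form the Apéry set with respect to `m` of the monoid
  -- generated by `m` and `gs`.
  Reducible : Exponent → Set
  Reducible a = ∃[ b ] b ≺ a × b ≈ a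

  reducible? : ∀ a → Dec (Reducible a)
  reducible? a = map′ satisfied
    -- A smaller exponent has at most the weight of `a`. As all weights in `gs` are positive, its
    -- entries are at most `φ gs a`, so a finite box contains every candidate.
    (λ { (b , b≺a , b≈a) → lose (∈-box b (λ i → s≤s (≤-trans (lookup≤φ gs gs>0 b i) (≺⇒φ≤φ b≺a)))) (b≺a , b≈a) })
    (any? (λ b → Lex.<-decidable _≟_ _<?_ (weighted b) (weighted a) ×-dec (φ gs b % m ≟ φ gs a % m))
          (box (suc (φ gs a)) _))

  reducible-⊕ : ∀ c {a} → Reducible a → Reducible (c ⊕ a)
  reducible-⊕ c (b , b≺a , b≈a) = c ⊕ b , ≺-⊕ c b≺a , ≈-⊕ c b≈a

  irreducible-unique : ∀ {a b} → ¬ Reducible a → ¬ Reducible b → a ≈ b → a ≡ b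
  irreducible-unique {a} {b} ¬ra ¬rb a≈b with ≺-total a b
  ... | inj₁ a≺b        = contradiction (a , a≺b , a≈b) ¬rb
  ... | inj₂ (inj₁ a≡b) = a≡b
  ... | inj₂ (inj₂ b≺a) = contradiction (b , b≺a , sym a≈b) ¬ra

  -- minimal generators of the monomial ideal of reducible exponents
  Corner : Exponent → Set
  Corner a = Reducible a × (∀ i → Reducible (a ⊖ single i 1) → lookup a i ≡ 0)

  corner? : ∀ a → Dec (Corner a)
  corner? a = reducible? a ×-dec Fin.all? (λ i → reducible? (a ⊖ single i 1) →-dec (lookup a i ≟ 0))

  -- If `c` had a positive entry, a unit could be removed there and the rest, still a multiple of
  -- `p`, would be reducible, against minimality.
  corner-⊕ : ∀ c {p} → Corner (c ⊕ p) → Reducible p → c ≡ 𝟘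
  corner-⊕ c {p} (_ , minimal) rp with zero-or-positive c
  ... | inj₁ c≡𝟘        = c≡𝟘
  ... | inj₂ (i , 1≤cᵢ) = contradiction (minimal i (subst Reducible (sym below) (reducible-⊕ (c ⊖ u) rp))) ≢0
    where
    u = single i 1
    1≤ : 1 ≤ lookup (c ⊕ p) i
    1≤ = ≤-trans 1≤cᵢ (≤-trans (m≤m+n _ _) (≤-reflexive (sym (lookup-zipWith _+_ i c p))))
    ≢0 : lookup (c ⊕ p) i ≢ 0
    ≢0 eq = 1+n≰n (≤-trans 1≤ (≤-reflexive eq))
    below : (c ⊕ p) ⊖ u ≡ (c ⊖ u) ⊕ p
    below = ⊕-cancelˡ u (begin
      u ⊕ ((c ⊕ p) ⊖ u) ≡⟨ single-⊕-⊖ i (c ⊕ p) 1≤ ⟩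
      c ⊕ p             ≡⟨ cong (_⊕ p) (single-⊕-⊖ i c 1≤cᵢ) ⟨
      (u ⊕ (c ⊖ u)) ⊕ p ≡⟨ ⊕-assoc u (c ⊖ u) p ⟩
      u ⊕ ((c ⊖ u) ⊕ p) ∎)
      where open ≡-Reasoning

  corner-antichain : ∀ c {a b} → b ≡ c ⊕ a → Corner a → Corner b → a ≡ b
  corner-antichain c {a} refl (ra , _) cb with corner-⊕ c cb ra
  ... | refl = sym (𝟘-⊕ a)

  -- Otherwise `corner-⊕` would force the removed multiple of the unit vector to vanish, and `suc j`
  -- would be 0.
  corner-⊖ : ∀ {a} i {j} → Corner a → suc j ≤ lookup a i → ¬ Reducible (a ⊖ single i (suc j))
  corner-⊖ {a} i {j} ca j<aᵢ r
    with single-injective i (trans (corner-⊕ (single i (suc j)) (subst Corner (sym (single-⊕-⊖ i a j<aᵢ)) ca) r) (single-0 i))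
    where
    single-0 : ∀ {n} (i : Fin n) → 𝟘 ≡ single i 0
    single-0 zero    = refl
    single-0 (suc i) = cong (0 ∷_) (single-0 i)
  ... | ()

  -- Removing one unit at `i` from both corners leaves irreducible exponents that are still
  -- congruent, and a residue class has only one of these.
  corner-residue-injective : ∀ i {a b} → Corner a → Corner b → 1 ≤ lookup a i → 1 ≤ lookup b i → a ≈ b → a ≡ b
  corner-residue-injective i {a} {b} ca cb 1≤aᵢ 1≤bᵢ a≈b = begin
    a             ≡⟨ single-⊕-⊖ i a 1≤aᵢ ⟨
    u ⊕ (a ⊖ u)   ≡⟨ cong (u ⊕_) (irreducible-unique (corner-⊖ i ca 1≤aᵢ) (corner-⊖ i cb 1≤bᵢ) below) ⟩
    u ⊕ (b ⊖ u)   ≡⟨ single-⊕-⊖ i b 1≤bᵢ ⟩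
    b             ∎
    where
    open ≡-Reasoning
    u = single i 1
    below : (a ⊖ u) ≈ (b ⊖ u)
    below = ≈-cancel-⊕ u (trans (cong (λ v → φ gs v % m) (single-⊕-⊖ i a 1≤aᵢ))
              (trans a≈b (cong (λ v → φ gs v % m) (sym (single-⊕-⊖ i b 1≤bᵢ)))))

  -- A corner shares no variable with an exponent that reduces it: otherwise
  -- a smaller exponent would already be reducible.
  full-support-corner≈𝟘 : ∀ {a} → Corner a → (∀ i → 1 ≤ lookup a i) → a ≈ 𝟘
  full-support-corner≈𝟘 {a} ca@((b , b≺a , b≈a) , _) 1≤a with zero-or-positive b
  ... | inj₁ refl       = sym b≈a
  ... | inj₂ (i , 1≤bᵢ) = contradiction (b ⊖ u , ≺-cancel-⊕ u (subst (_≺ u ⊕ (a ⊖ u)) (sym b-split) (subst (b ≺_) (sym a-split) b≺a))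
                                              , ≈-cancel-⊕ u (subst (_≈ u ⊕ (a ⊖ u)) (sym b-split) (subst (b ≈_) (sym a-split) b≈a)))
                              (corner-⊖ i ca (1≤a i))
    where
    u = single i 1
    a-split : u ⊕ (a ⊖ u) ≡ a
    a-split = single-⊕-⊖ i a (1≤a i)
    b-split : u ⊕ (b ⊖ u) ≡ b
    b-split = single-⊕-⊖ i b 1≤bᵢ

  full-support-corner-unique : ∀ {a b} → Corner a → Corner b →
    (∀ i → 1 ≤ lookup a i) → (∀ i → 1 ≤ lookup b i) → a ≡ b
  full-support-corner-unique ca cb 1≤a 1≤b = corner-residue-injective zero ca cb (1≤a zero) (1≤b zero)
    (trans (full-support-corner≈𝟘 ca 1≤a) (sym (full-support-corner≈𝟘 cb 1≤b)))

  -- Both differences are irreducible and congruent, hence one exponent `p`. So `b` is `a` plus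
  -- `j′ ∸ j` units at `i`, and corners form an antichain.
  corner-⊖-injective-ordered : ∀ i {a b j j′} → Corner a → Corner b →
    suc j ≤ lookup a i → suc j′ ≤ lookup b i → j ≤ j′ →
    (a ⊖ single i (suc j)) ≈ (b ⊖ single i (suc j′)) → a ≡ b × j ≡ j′
  corner-⊖-injective-ordered i {a} {b} {j} {j′} ca cb j<aᵢ j′<bᵢ j≤j′ eq = a≡b , suc-injective (single-injective i e≡e′)
    where
    open ≡-Reasoning
    p e e′ : Exponent
    p  = a ⊖ single i (suc j)
    e  = single i (suc j)
    e′ = single i (suc j′)
    a-split : e ⊕ p ≡ a
    a-split = single-⊕-⊖ i a j<aᵢ
    b-split : e′ ⊕ p ≡ b
    b-split = trans (cong (e′ ⊕_) (irreducible-unique (corner-⊖ i ca j<aᵢ) (corner-⊖ i cb j′<bᵢ) eq))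
                    (single-⊕-⊖ i b j′<bᵢ)
    a≡b : a ≡ b
    a≡b = corner-antichain (single i (j′ ∸ j)) (begin
      b                                    ≡⟨ b-split ⟨
      e′ ⊕ p                               ≡⟨ cong (λ l → single i l ⊕ p) (trans (+-suc (j′ ∸ j) j) (cong suc (m∸n+n≡m j≤j′))) ⟨
      single i (j′ ∸ j + suc j) ⊕ p        ≡⟨ cong (_⊕ p) (single-+ i (j′ ∸ j) (suc j)) ⟩
      (single i (j′ ∸ j) ⊕ e) ⊕ p          ≡⟨ ⊕-assoc _ e p ⟩
      single i (j′ ∸ j) ⊕ (e ⊕ p)          ≡⟨ cong (single i (j′ ∸ j) ⊕_) a-split ⟩
      single i (j′ ∸ j) ⊕ a                ∎) ca cb
    e≡e′ : e ≡ e′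
    e≡e′ = ⊕-cancelˡ p (begin
      p ⊕ e  ≡⟨ ⊕-comm p e ⟩
      e ⊕ p  ≡⟨ a-split ⟩
      a      ≡⟨ a≡b ⟩
      b      ≡⟨ b-split ⟨
      e′ ⊕ p ≡⟨ ⊕-comm e′ p ⟩
      p ⊕ e′ ∎)

  corner-⊖-injective : ∀ i {a b j j′} → Corner a → Corner b →
    suc j ≤ lookup a i → suc j′ ≤ lookup b i →
    (a ⊖ single i (suc j)) ≈ (b ⊖ single i (suc j′)) → a ≡ b × j ≡ j′
  corner-⊖-injective i {j = j} {j′} ca cb j<aᵢ j′<bᵢ eq with ≤-total j j′
  ... | inj₁ j≤j′ = corner-⊖-injective-ordered i ca cb j<aᵢ j′<bᵢ j≤j′ eq
  ... | inj₂ j′≤j with corner-⊖-injective-ordered i cb ca j′<bᵢ j<aᵢ j′≤j (sym eq)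
  ...   | b≡a , j′≡j = sym b≡a , sym j′≡j

  -- Counting the corners

  length-tall-corners : ∀ t (idx : Exponent → Fin (2 + k)) (xs : List Exponent) → Unique xs →
    (∀ {a} → a ∈ xs → Corner a × t ≤ lookup a (idx a)) → length xs * t ≤ (2 + k) * m
  length-tall-corners t idx xs xs! tall = subst₂ _≤_ domain-size codomain-size
    (length-≤-injection f (Unique.cartesianProduct⁺ xs! (Unique.upTo⁺ t)) f-injective f-into)
    where
    -- Each corner yields `t` irreducible exponents below it in the direction `idx a`. A direction
    -- and a residue together determine both the corner and the number of units removed.
    f : Exponent × ℕ → Fin (2 + k) × ℕ
    f (a , j) = idx a , φ gs (a ⊖ single (idx a) (suc j)) % m

    pairs : List (Exponent × ℕ)
    pairs = cartesianProduct xs (upTo t)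

    targets : List (Fin (2 + k) × ℕ)
    targets = cartesianProduct (allFin (2 + k)) (upTo m)

    domain-size : length pairs ≡ length xs * t
    domain-size = trans (length-cartesianProductWith _,_ xs (upTo t)) (cong (length xs *_) (length-upTo t))

    codomain-size : length targets ≡ (2 + k) * m
    codomain-size = trans (length-cartesianProductWith _,_ (allFin (2 + k)) (upTo m))
      (cong₂ _*_ (length-tabulate {n = 2 + k} (λ i → i)) (length-upTo m))

    in-range : ∀ {a j} → (a , j) ∈ pairs → Corner a × suc j ≤ lookup a (idx a)
    in-range aj∈ with ∈-cartesianProduct⁻ xs (upTo t) aj∈
    ... | a∈ , j∈ = proj₁ (tall a∈) , ≤-trans (∈-upTo⁻ j∈) (proj₂ (tall a∈))

    f-into : ∀ {x} → x ∈ pairs → f x ∈ targets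
    f-into {a , j} _ = ∈-cartesianProduct⁺ (∈-allFin (idx a)) (∈-upTo⁺ (m%n<n _ m))

    f-injective : ∀ {x y} → x ∈ pairs → y ∈ pairs → f x ≡ f y → x ≡ y
    f-injective {a , j} {b , j′} x∈ y∈ eq
      with in-range x∈ | in-range y∈ | ,-injective eq
    ... | ca , j<aᵢ | cb , j′<bᵢ | i≡i′ , res≡
      with corner-⊖-injective (idx a) ca cb j<aᵢ (subst (λ i → suc j′ ≤ lookup b i) (sym i≡i′) j′<bᵢ)
             (trans res≡ (cong (λ i → φ gs (b ⊖ single i (suc j′)) % m) (sym i≡i′)))
    ...   | a≡b , j≡j′ = cong₂ _,_ a≡b j≡j′

  -- The tall-corner count is applied to the one-element list with `t` the entry itself, which
  -- bounds that entry by `(2 + k) * m`. So the corners are finite in number and can be listed.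
  corner-in-box : ∀ {a} → Corner a → a ∈ box (suc ((2 + k) * m)) (2 + k)
  corner-in-box {a} ca = ∈-box a (λ i → s≤s (≤-trans (≤-reflexive (sym (+-identityʳ _)))
    (length-tall-corners (lookup a i) (λ _ → i) (a ∷ []) ([] ∷ []) λ { (here refl) → ca , ≤-refl })))

  -- On the face where entry `i` is 0, corners that agree in all remaining entries but one are
  -- comparable, hence equal by the antichain property.
  corner-face-injective-ordered : ∀ i {a b} x y (v : Vec ℕ k) → Corner a → Corner b →
    a ≡ insertAt (x ∷ v) i 0 → b ≡ insertAt (y ∷ v) i 0 → x ≤ y → a ≡ b
  corner-face-injective-ordered i x y v ca cb refl refl x≤y =
    corner-antichain (insertAt ((y ∸ x) ∷ 𝟘) i 0)
      (trans (cong (λ w → insertAt w i 0) (cong₂ _∷_ (sym (m∸n+n≡m x≤y)) (sym (𝟘-⊕ v))))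
             (insertAt-⊕ ((y ∸ x) ∷ 𝟘) (x ∷ v) i))
      ca cb

  corner-face-injective : ∀ i {a b} → Corner a → Corner b → lookup a i ≡ 0 → lookup b i ≡ 0 →
    tail (removeAt a i) ≡ tail (removeAt b i) → a ≡ b
  corner-face-injective i {a} {b} ca cb aᵢ≡0 bᵢ≡0 eq
    with removeAt a i | removeAt b i | insertAt-removeAt a i | insertAt-removeAt b i
  ... | x ∷ v | y ∷ w | a-split | b-split with ≤-total x y | eq
  ...   | inj₁ x≤y | refl = corner-face-injective-ordered i x y v ca cb
                              (trans (sym a-split) (cong (insertAt (x ∷ v) i) aᵢ≡0))
                              (trans (sym b-split) (cong (insertAt (y ∷ v) i) bᵢ≡0)) x≤y
  ...   | inj₂ y≤x | refl = sym (corner-face-injective-ordered i y x v cb ca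
                              (trans (sym b-split) (cong (insertAt (y ∷ v) i) bᵢ≡0))
                              (trans (sym a-split) (cong (insertAt (x ∷ v) i) aᵢ≡0)) y≤x)

  length-flat-corners : ∀ t (xs : List Exponent) → Unique xs →
    (∀ {a} → a ∈ xs → Corner a × (∃[ i ] lookup a i ≡ 0) × (∀ i → lookup a i < t)) →
    length xs ≤ (2 + k) * t ^ k
  length-flat-corners t xs xs! flat = ≤-trans (length-≤-injection f xs! f-injective f-into) (≤-reflexive codomain-size)
    where
    face : Exponent → Fin (2 + k)
    face = pick (_≟ 0)

    -- A zero entry is dropped, and then the first remaining entry, which the antichain property
    -- recovers. This is what leaves `k` free entries and the power `t ^ k`.
    f : Exponent → Fin (2 + k) × Vec ℕ k
    f a = face a , tail (removeAt a (face a))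

    codomain-size : length (cartesianProduct (allFin (2 + k)) (box t k)) ≡ (2 + k) * t ^ k
    codomain-size = trans (length-cartesianProductWith _,_ (allFin (2 + k)) (box t k))
      (cong₂ _*_ (length-tabulate {n = 2 + k} (λ i → i)) (length-box t k))

    lookup-tail : ∀ {n} (v : Vec ℕ (suc n)) j → lookup (tail v) j ≡ lookup v (suc j)
    lookup-tail (_ ∷ _) j = refl

    f-into : ∀ {a} → a ∈ xs → f a ∈ cartesianProduct (allFin (2 + k)) (box t k)
    f-into {a} a∈ = ∈-cartesianProduct⁺ (∈-allFin (face a)) (∈-box _ small)
      where
      small : ∀ j → lookup (tail (removeAt a (face a))) j < t
      small j with lookup-removeAt a (face a) (suc j)
      ... | l , eq = subst (_< t) (sym (trans (lookup-tail (removeAt a (face a)) j) eq)) (proj₂ (proj₂ (flat a∈)) l)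

    f-injective : ∀ {a b} → a ∈ xs → b ∈ xs → f a ≡ f b → a ≡ b
    f-injective {a} {b} a∈ b∈ eq with ,-injective eq
    ... | i≡i′ , rest≡ = corner-face-injective (face a) (proj₁ (flat a∈)) (proj₁ (flat b∈))
      (pick-satisfies (_≟ 0) a (proj₁ (proj₂ (flat a∈))))
      (subst (λ i → lookup b i ≡ 0) (sym i≡i′) (pick-satisfies (_≟ 0) b (proj₁ (proj₂ (flat b∈)))))
      (trans rest≡ (cong (λ i → tail (removeAt b i)) (sym i≡i′)))

  corners : List Exponent
  corners = filter corner? (box (suc ((2 + k) * m)) (2 + k))

  corner∈corners : ∀ {a} → Corner a → a ∈ corners
  corner∈corners ca = ∈-filter⁺ corner? (corner-in-box ca) ca

  corners-sound : ∀ {a} → a ∈ corners → Corner a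
  corners-sound a∈ = proj₂ (∈-filter⁻ corner? {xs = box (suc ((2 + k) * m)) (2 + k)} a∈)

  corners-unique : Unique corners
  corners-unique = Unique.filter⁺ corner? (box-unique (suc ((2 + k) * m)) (2 + k))

  -- s counts the corners with an entry ≥ t, 1 those of full support, and the
  -- last term those in the box [0, t) that have a zero entry.
  length-corners : ∀ t → ∃[ s ] s * t ≤ (2 + k) * m × length corners ≤ s + (1 + (2 + k) * t ^ k)
  length-corners t = length talls , talls-bound ,
    ≤-trans (length-filter-cover tall? low? corners tall-or-low)
      (+-monoʳ-≤ (length talls) (≤-trans (length-filter-cover full? face? lows full-or-face)
        (+-mono-≤ fulls-bound faces-bound)))
    where
    tall? : (a : Exponent) → Dec (∃[ i ] t ≤ lookup a i)
    tall? a = Fin.any? (λ i → t ≤? lookup a i)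
    low? : (a : Exponent) → Dec (∀ i → lookup a i < t)
    low? a = Fin.all? (λ i → lookup a i <? t)
    full? : (a : Exponent) → Dec (∀ i → 1 ≤ lookup a i)
    full? a = Fin.all? (λ i → 1 ≤? lookup a i)
    face? : (a : Exponent) → Dec (∃[ i ] lookup a i ≡ 0)
    face? a = Fin.any? (λ i → lookup a i ≟ 0)

    talls lows fulls faces : List Exponent
    talls = filter tall? corners
    lows  = filter low? corners
    fulls = filter full? lows
    faces = filter face? lows

    tall-or-low : ∀ {a} → a ∈ corners → (∃[ i ] t ≤ lookup a i) ⊎ (∀ i → lookup a i < t)
    tall-or-low {a} _ with tall? a
    ... | yes tall = inj₁ tall
    ... | no ¬tall = inj₂ (λ i → ≰⇒> (λ t≤ → ¬tall (i , t≤)))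

    full-or-face : ∀ {a} → a ∈ lows → (∀ i → 1 ≤ lookup a i) ⊎ (∃[ i ] lookup a i ≡ 0)
    full-or-face {a} _ with face? a
    ... | yes face = inj₂ face
    ... | no ¬face = inj₁ (λ i → n≢0⇒n>0 (λ ≡0 → ¬face (i , ≡0)))

    talls-bound : length talls * t ≤ (2 + k) * m
    talls-bound = length-tall-corners t (pick (t ≤?_)) talls (Unique.filter⁺ tall? corners-unique) tall
      where
      tall : ∀ {a} → a ∈ talls → Corner a × t ≤ lookup a (pick (t ≤?_) a)
      tall {a} a∈ = let a∈corners , t≤ = ∈-filter⁻ tall? {xs = corners} a∈ in
        corners-sound a∈corners , pick-satisfies (t ≤?_) a t≤

    low-corner : ∀ {a} → a ∈ lows → Corner a × (∀ i → lookup a i < t)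
    low-corner a∈ = let a∈corners , low = ∈-filter⁻ low? {xs = corners} a∈ in corners-sound a∈corners , low

    lows-unique : Unique lows
    lows-unique = Unique.filter⁺ low? corners-unique

    fulls-bound : length fulls ≤ 1
    fulls-bound = length-≤-injection {ys = tt ∷ []} (λ _ → tt) (Unique.filter⁺ full? lows-unique)
      (λ a∈ b∈ _ → same (∈-filter⁻ full? {xs = lows} a∈) (∈-filter⁻ full? {xs = lows} b∈)) (λ _ → here refl)
      where
      same : ∀ {a b} → a ∈ lows × (∀ i → 1 ≤ lookup a i) → b ∈ lows × (∀ i → 1 ≤ lookup b i) → a ≡ b
      same (a∈ , 1≤a) (b∈ , 1≤b) =
        full-support-corner-unique (proj₁ (low-corner a∈)) (proj₁ (low-corner b∈)) 1≤a 1≤b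

    faces-bound : length faces ≤ (2 + k) * t ^ k
    faces-bound = length-flat-corners t faces (Unique.filter⁺ face? lows-unique) flat
      where
      flat : ∀ {a} → a ∈ faces → Corner a × (∃[ i ] lookup a i ≡ 0) × (∀ i → lookup a i < t)
      flat a∈ = let a∈lows , face = ∈-filter⁻ face? {xs = lows} a∈ in
        proj₁ (low-corner a∈lows) , face , proj₂ (low-corner a∈lows)

  -- The presentation of the kernel given by the corners

  residual : Exponent → Exponent → ℕ
  residual a b = φ gs a / m ∸ φ gs b / m

  -- Congruent weights have equal remainders, so they differ by `m` times the difference of the
  -- quotients. That difference is not truncated, because `b ≺ a` orders the weights.
  residual-φ : ∀ {a b} → b ≺ a → b ≈ a → φ gs a ≡ residual a b * m + φ gs b
  residual-φ {a} {b} b≺a b≈a = begin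
    φ gs a                                             ≡⟨ m≡m%n+[m/n]*n (φ gs a) m ⟩
    φ gs a % m + qa * m                                ≡⟨ cong₂ (λ r q → r + q * m) (sym b≈a) (sym (m∸n+n≡m qb≤qa)) ⟩
    φ gs b % m + (qa ∸ qb + qb) * m                    ≡⟨ cong (φ gs b % m +_) (*-distribʳ-+ m (qa ∸ qb) qb) ⟩
    φ gs b % m + ((qa ∸ qb) * m + qb * m)              ≡⟨ x∙yz≈y∙xz +-commutativeSemigroup (φ gs b % m) ((qa ∸ qb) * m) (qb * m) ⟩
    (qa ∸ qb) * m + (φ gs b % m + qb * m)              ≡⟨ cong ((qa ∸ qb) * m +_) (m≡m%n+[m/n]*n (φ gs b) m) ⟨
    (qa ∸ qb) * m + φ gs b                             ∎
    where
    open ≡-Reasoning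
    qa qb : ℕ
    qa = φ gs a / m
    qb = φ gs b / m
    qb≤qa : qb ≤ qa
    qb≤qa = /-monoˡ-≤ m (≺⇒φ≤φ b≺a)

  Relation : Set
  Relation = Vec ℕ (3 + k) × Vec ℕ (3 + k)

  -- The decision is an argument so that lemmas can match on it. The `no` case is a default giving a
  -- trivial relation; it never occurs at a corner.
  reduct : (a : Exponent) → Dec (Reducible a) → Vec ℕ (3 + k)
  reduct a (yes (b , _)) = residual a b ∷ b
  reduct a (no _)        = 0 ∷ a

  relation : Exponent → Relation
  relation a = (0 ∷ a) , reduct a (reducible? a)

  relations : List Relation
  relations = map relation corners

  reduct-φ : ∀ a (r : Dec (Reducible a)) → φ gs a ≡ φ (m ∷ gs) (reduct a r)
  reduct-φ a (yes (b , b≺a , b≈a)) = residual-φ b≺a b≈a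
  reduct-φ a (no _)                = refl

  relations-sound : ∀ {a b} → CongClosure relations a b → φ (m ∷ gs) a ≡ φ (m ∷ gs) b
  relations-sound (base ab∈) with ∈-map⁻ relation ab∈
  ... | a , _ , refl = reduct-φ a (reducible? a)
  relations-sound CongClosure.refl        = refl
  relations-sound (CongClosure.sym p)     = sym (relations-sound p)
  relations-sound (CongClosure.trans p q) = trans (relations-sound p) (relations-sound q)
  relations-sound (plus {a} {b} {c} {d} p q) = trans (φ-⊕ (m ∷ gs) a c)
    (trans (cong₂ _+_ (relations-sound p) (relations-sound q)) (sym (φ-⊕ (m ∷ gs) b d)))

  ⊖-single-≺ : ∀ i {a} → 1 ≤ lookup a i → a ⊖ single i 1 ≺ a
  ⊖-single-≺ i {a} 1≤aᵢ = this (begin-strict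
    φ gs (a ⊖ u)            <⟨ m<n+m (φ gs (a ⊖ u)) 1≤φu ⟩
    φ gs u + φ gs (a ⊖ u)   ≡⟨ φ-⊕ gs u (a ⊖ u) ⟨
    φ gs (u ⊕ (a ⊖ u))      ≡⟨ cong (φ gs) (single-⊕-⊖ i a 1≤aᵢ) ⟩
    φ gs a                  ∎) refl
    where
    open ≤-Reasoning
    u : Exponent
    u = single i 1
    1≤φu : 1 ≤ φ gs u
    1≤φu = ≤-trans (≤-reflexive (sym (lookup-single i 1))) (lookup≤φ gs gs>0 u i)

  -- Units are removed as long as the rest stays reducible. Each removal lowers the weight, and an
  -- exponent at which the process stops is a corner.
  corner-below : ∀ a → Reducible a → ∃[ c ] ∃[ p ] Corner p × a ≡ c ⊕ p
  corner-below a = descend a (≺-wellFounded a)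
    where
    descend : ∀ a → Acc _≺_ a → Reducible a → ∃[ c ] ∃[ p ] Corner p × a ≡ c ⊕ p
    descend a (acc smaller) r with Fin.any? (λ i → reducible? (a ⊖ single i 1) ×-dec (1 ≤? lookup a i))
    ... | no none = 𝟘 , a , (r , λ i ri → n<1⇒n≡0 (≰⇒> (λ 1≤ → none (i , ri , 1≤)))) , sym (𝟘-⊕ a)
    ... | yes (i , ri , 1≤aᵢ) with descend (a ⊖ single i 1) (smaller (⊖-single-≺ i 1≤aᵢ)) ri
    ...   | c , p , cp , eq = single i 1 ⊕ c , p , cp ,
      trans (sym (single-⊕-⊖ i a 1≤aᵢ)) (trans (cong (single i 1 ⊕_) eq) (sym (⊕-assoc (single i 1) c p)))

  -- The target consists of `c` copies of the generator `m` and an irreducible exponent in the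
  -- others.
  NormalForm : Vec ℕ (3 + k) → Set
  NormalForm a = ∃[ c ] ∃[ o ] ¬ Reducible o × CongClosure relations a (c ∷ o)

  reduct-smaller : ∀ {a} → Reducible a → (r : Dec (Reducible a)) → ∃[ b ] ∃[ c ] b ≺ a × reduct a r ≡ c ∷ b
  reduct-smaller     _  (yes (b , b≺a , _)) = b , _ , b≺a , refl
  reduct-smaller     ra (no ¬ra)            = contradiction ra ¬ra

  relation∈relations : ∀ {a} → Corner a → ∃[ b ] ∃[ c ] b ≺ a × (0 ∷ a , c ∷ b) ∈ relations
  relation∈relations {a} ca with reduct-smaller (proj₁ ca) (reducible? a)
  ... | b , c , b≺a , eq = b , c , b≺a ,
    subst (λ v → (0 ∷ a , v) ∈ relations) eq (∈-map⁺ relation (corner∈corners ca))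

  closure-⊕ : ∀ c {a b} → CongClosure relations a b → CongClosure relations (c ⊕ a) (c ⊕ b)
  closure-⊕ c p = plus CongClosure.refl p

  normalForm-⊕ : ∀ x a → NormalForm (0 ∷ a) → NormalForm (x ∷ a)
  normalForm-⊕ x a (c , o , ¬ro , red) = x + c , o , ¬ro ,
    subst₂ (CongClosure relations) (cong₂ _∷_ (+-identityʳ x) (𝟘-⊕ a)) (cong (x + c ∷_) (𝟘-⊕ o)) (closure-⊕ (x ∷ 𝟘) red)

  normalForm-step : ∀ {a b} → CongClosure relations a b → NormalForm b → NormalForm a
  normalForm-step a~b (c , o , ¬ro , red) = c , o , ¬ro , CongClosure.trans a~b red

  -- A reducible exponent is `d ⊕ p` with `p` a corner. The relation of `p` replaces it by `d ⊕ b`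
  -- and some copies of `m`, and `d ⊕ b` is smaller because the order is translation invariant.
  normalForm-exponent : ∀ a → Acc _≺_ a → NormalForm (0 ∷ a)
  normalForm-exponent a (acc smaller) with reducible? a
  ... | no ¬r = 0 , a , ¬r , CongClosure.refl
  ... | yes r = reduce (corner-below a r)
    where
    reduce : ∃[ c ] ∃[ p ] Corner p × a ≡ c ⊕ p → NormalForm (0 ∷ a)
    reduce (d , p , cp , refl) = apply (relation∈relations cp)
      where
      apply : ∃[ b ] ∃[ c ] b ≺ p × (0 ∷ p , c ∷ b) ∈ relations → NormalForm (0 ∷ (d ⊕ p))
      apply (b , c , b≺p , r∈) = normalForm-step (closure-⊕ (0 ∷ d) (base r∈))
        (normalForm-⊕ c (d ⊕ b) (normalForm-exponent (d ⊕ b) (smaller (≺-⊕ d b≺p))))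

  normalForm : ∀ a → NormalForm a
  normalForm (x ∷ a) = normalForm-⊕ x a (normalForm-exponent a (≺-wellFounded a))

  -- Modulo `m` the first coordinate disappears, so the irreducible parts are congruent and hence
  -- equal. Cancelling their weight and then `m` gives equal first coordinates.
  normalForm-unique : ∀ {x y o o′} → ¬ Reducible o → ¬ Reducible o′ →
    φ (m ∷ gs) (x ∷ o) ≡ φ (m ∷ gs) (y ∷ o′) → x ∷ o ≡ y ∷ o′
  normalForm-unique {x} {y} {o} {o′} ¬ro ¬ro′ eq with irreducible-unique ¬ro ¬ro′ o≈o′
    where
    o≈o′ : o ≈ o′
    o≈o′ = trans (drop-multiple x o) (trans (cong (_% m) eq) (sym (drop-multiple y o′)))
      where
      drop-multiple : ∀ x o → φ gs o % m ≡ (x * m + φ gs o) % m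
      drop-multiple x o = trans (sym ([m+kn]%n≡m%n (φ gs o) x m)) (cong (_% m) (+-comm (φ gs o) (x * m)))
  ... | refl = cong (_∷ o) (*-cancelʳ-≡ x y m (+-cancelʳ-≡ (φ gs o) (x * m) (y * m) eq))

  -- Reduction preserves the value under `φ (m ∷ gs)`, so exponents of equal value reach the same
  -- normal form and are linked through it.
  normalForms-agree : ∀ {a b} → NormalForm a → NormalForm b → φ (m ∷ gs) a ≡ φ (m ∷ gs) b → CongClosure relations a b
  normalForms-agree {a} {b} (x , o , ¬ro , a~) (y , o′ , ¬ro′ , b~) eq =
    CongClosure.trans a~ (subst (λ v → CongClosure relations v b) (sym same) (CongClosure.sym b~))
    where
    same : x ∷ o ≡ y ∷ o′
    same = normalForm-unique {x} {y} {o} {o′} ¬ro ¬ro′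
      (trans (sym (relations-sound {a} {x ∷ o} a~)) (trans eq (relations-sound {b} {y ∷ o′} b~)))

  relations-generate : GeneratesKer (m ∷ gs) relations
  relations-generate a b = mk⇔ (normalForms-agree {a} {b} (normalForm a) (normalForm b)) (relations-sound {a} {b})

  few-relations : ∀ t → ∃[ ρs ] GeneratesKer (m ∷ gs) ρs ×
    ∃[ s ] s * t ≤ (2 + k) * m × length ρs ≤ s + (1 + (2 + k) * t ^ k)
  few-relations t = relations , relations-generate , bound (length-corners t)
    where
    bound : ∃[ s ] s * t ≤ (2 + k) * m × length corners ≤ s + (1 + (2 + k) * t ^ k) →
            ∃[ s ] s * t ≤ (2 + k) * m × length relations ≤ s + (1 + (2 + k) * t ^ k)
    bound (s , st≤ , len≤) = s , st≤ , ≤-trans (≤-reflexive (length-map relation corners)) len≤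

-- Binomial coefficients and the Macaulay bound

nC0≡1 : ∀ n → n C 0 ≡ 1
nC0≡1 zero = refl
nC0≡1 (suc n) = refl

-- Pascal's rule for binomials written `(e + r) C r`, the shape in which the inductions on `e` and
-- `r` below proceed.
pascal : ∀ e r → (suc e + suc r) C suc r ≡ (suc e + r) C r + (e + suc r) C suc r
pascal e r = trans (sym (nCk+nC[k+1]≡[n+1]C[k+1] (e + suc r) r)) (cong (λ n → n C r + (e + suc r) C suc r) (+-suc e r))

-- Double induction along Pascal's rule. One copy of `b` is set aside, the hypotheses at
-- `(suc e, r)` and `(e, suc r)` rewrite the other terms, and the spare copy is expanded by Pascal's
-- rule again.
C-absorption : ∀ e r → suc e * ((suc e + r) C r) ≡ (suc e + r) * ((e + r) C r)
C-absorption zero r = trans (+-identityʳ (suc r C r)) (trans (suc-C r) (sym (trans (cong (suc r *_) (nCn≡1 r)) (*-identityʳ (suc r)))))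
  where
  suc-C : ∀ r → suc r C r ≡ suc r
  suc-C zero = refl
  suc-C (suc r) = trans (sym (nCk+nC[k+1]≡[n+1]C[k+1] (suc r) r)) (trans (cong₂ _+_ (suc-C r) (nCn≡1 (suc r))) (+-comm (suc r) 1))
C-absorption (suc e) zero = cong₂ _*_ (sym (+-identityʳ (2 + e))) (trans (nC0≡1 (2 + e + 0)) (sym (nC0≡1 (suc e + 0))))
C-absorption (suc e) (suc r) = begin
  suc (suc e) * ((suc (suc e) + suc r) C suc r)
    ≡⟨ cong (suc (suc e) *_) (pascal (suc e) r) ⟩
  suc (suc e) * (a + b)
    ≡⟨ step₁ e a b ⟩
  suc (suc e) * a + (suc e * b + b)
    ≡⟨ cong₂ (λ u v → u + (v + b)) (C-absorption (suc e) r) (C-absorption e (suc r)) ⟩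
  (suc (suc e) + r) * c + ((suc e + suc r) * d + b)
    ≡⟨ cong (λ z → (suc (suc e) + r) * c + ((suc e + suc r) * d + z)) (pascal e r) ⟩
  (suc (suc e) + r) * c + ((suc e + suc r) * d + (c + d))
    ≡⟨ step₂ e r c d ⟩
  (suc (suc e) + suc r) * (c + d)
    ≡⟨ cong ((suc (suc e) + suc r) *_) (pascal e r) ⟨
  (suc (suc e) + suc r) * b ∎
  where
  open ≡-Reasoning
  a b c d : ℕ
  a = (suc (suc e) + r) C r
  b = (suc e + suc r) C suc r
  c = (suc e + r) C r
  d = (e + suc r) C suc r
  step₁ : ∀ e a b → suc (suc e) * (a + b) ≡ suc (suc e) * a + (suc e * b + b)
  step₁ = solve-∀
  step₂ : ∀ e r c d → (suc (suc e) + r) * c + ((suc e + suc r) * d + (c + d)) ≡ (suc (suc e) + suc r) * (c + d)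
  step₂ = solve-∀

-- The right-hand side is the product of the `e` factors `r + 1`, ..., `r + e`, assembled one factor
-- at a time by `C-absorption`.
^≤!*C : ∀ e r → r ^ e ≤ e ! * ((e + r) C r)
^≤!*C zero r = ≤-reflexive (sym (trans (+-identityʳ (r C r)) (nCn≡1 r)))
^≤!*C (suc e) r = begin
  r * r ^ e                           ≤⟨ *-mono-≤ (m≤n+m r (suc e)) (^≤!*C e r) ⟩
  (suc e + r) * (e ! * ((e + r) C r)) ≡⟨ *-exchange (suc e + r) (e !) _ ⟩
  e ! * ((suc e + r) * ((e + r) C r)) ≡⟨ cong (e ! *_) (C-absorption e r) ⟨
  e ! * (suc e * ((suc e + r) C r))   ≡⟨ step (e !) (suc e) _ ⟩
  suc e ! * ((suc e + r) C r)         ∎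
  where
  open ≤-Reasoning
  *-exchange : ∀ x y z → x * (y * z) ≡ y * (x * z)
  *-exchange = solve-∀
  step : ∀ x y z → x * (y * z) ≡ (y * x) * z
  step = solve-∀

C-monoʳ-≤ : ∀ e {r r′} → r ≤ r′ → (e + r) C r ≤ (e + r′) C r′
C-monoʳ-≤ zero    {r} {r′} _ = ≤-reflexive (trans (nCn≡1 r) (sym (nCn≡1 r′)))
C-monoʳ-≤ (suc e) {zero}  {r′} _ = ≤-trans (≤-reflexive (nC0≡1 (suc e + 0))) (1≤C (suc e) r′)
  where
  1≤C : ∀ e r → 1 ≤ (e + r) C r
  1≤C zero    r       = ≤-reflexive (sym (nCn≡1 r))
  1≤C (suc e) zero    = ≤-refl
  1≤C (suc e) (suc r) = ≤-trans (1≤C (suc e) r) (≤-trans (m≤m+n _ _) (≤-reflexive (sym (pascal e r))))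
C-monoʳ-≤ (suc e) {suc r} {suc r′} (s≤s r≤r′) = begin
  (suc e + suc r) C suc r                    ≡⟨ pascal e r ⟩
  (suc e + r) C r + (e + suc r) C suc r      ≤⟨ +-mono-≤ (C-monoʳ-≤ (suc e) r≤r′) (C-monoʳ-≤ e (s≤s r≤r′)) ⟩
  (suc e + r′) C r′ + (e + suc r′) C suc r′  ≡⟨ pascal e r′ ⟨
  (suc e + suc r′) C suc r′                  ∎
  where open ≤-Reasoning

r<C : ∀ e r → r < (suc e + r) C r
r<C e       zero    = ≤-reflexive (sym (nC0≡1 (suc e + 0)))
r<C zero    (suc r) = ≤-reflexive (begin
  suc (suc r)                 ≡⟨ *-identityʳ (suc (suc r)) ⟨
  suc (suc r) * 1             ≡⟨ cong (suc (suc r) *_) (nCn≡1 (suc r)) ⟨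
  suc (suc r) * (suc r C suc r) ≡⟨ C-absorption 0 (suc r) ⟨
  1 * (suc (suc r) C suc r)   ≡⟨ *-identityˡ _ ⟩
  suc (suc r) C suc r         ∎)
  where open ≡-Reasoning
r<C (suc e) (suc r) = begin-strict
  suc r                                           ≡⟨ +-comm 1 r ⟩
  r + 1                                           <⟨ +-mono-<-≤ (r<C (suc e) r) (≤-trans (s≤s z≤n) (r<C e (suc r))) ⟩
  (suc (suc e) + r) C r + (suc e + suc r) C suc r ≡⟨ pascal (suc e) r ⟨
  (suc (suc e) + suc r) C suc r                   ∎
  where open ≤-Reasoning

-- Either the test succeeds during the search, or the fuel runs out with `m ≤ r`, where `r<C` gives
-- the same inequality. Fuel `m` from the start 1, as in `rOf`, meets the hypothesis.
findR-bound : ∀ e m f r → m ≤ f + r → m < (suc e + findR (suc e) m f r) C findR (suc e) m f r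
findR-bound e m zero    r m≤r = ≤-<-trans m≤r (r<C e r)
findR-bound e m (suc f) r m≤f+r with m <ᵇ ((suc e + r) C r) in eq
... | true  = <ᵇ⇒< m _ (subst T (sym eq) tt)
... | false = findR-bound e m f (suc r) (≤-trans m≤f+r (≤-reflexive (sym (+-suc f r))))

findR-≥ : ∀ e m f r → r ≤ findR e m f r
findR-≥ e m zero    r = ≤-refl
findR-≥ e m (suc f) r with m <ᵇ ((e + r) C r)
... | true  = ≤-refl
... | false = ≤-trans (n≤1+n r) (findR-≥ e m f (suc r))

-- In degree 1 the greedy choice is exact because `k C 1` is `k`: the search rejects its starting
-- point `n + 1` and stops at `n`.
largestK-1 : ∀ n → largestK n 1 (n + 1) ≡ n
largestK-1 n = trans (cong (largestK n 1) (+-comm n 1)) (too-large n)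
  where
  fits : ∀ n → largestK n 1 n ≡ n
  fits zero = refl
  fits (suc n) with (suc n C 1) ≤ᵇ suc n in eq
  ... | true  = refl
  ... | false = contradiction (subst T eq (≤⇒≤ᵇ (≤-reflexive (nC1≡n (suc n))))) (λ ())

  too-large : ∀ n → largestK n 1 (suc n) ≡ n
  too-large n with (suc n C 1) ≤ᵇ n in eq
  ... | true  = contradiction (≤-trans (≤-reflexive (sym (nC1≡n (suc n)))) (≤ᵇ⇒≤ _ n (subst T (sym eq) tt))) 1+n≰n
  ... | false = fits n

-- By Pascal's rule each greedy term does not decrease when both its indices are raised, and the
-- remainder is handled by induction. In degree 1 no further term follows, so there the exact greedy
-- choice is used.
n≤macUp : ∀ d n → n ≤ macUp (suc d) n
n≤macUp d       zero    = z≤n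
n≤macUp zero    (suc n) = begin
  suc n                              ≡⟨ largestK-1 (suc n) ⟨
  k                                  ≡⟨ nC1≡n k ⟨
  k C 1                              ≤⟨ m≤m+n _ _ ⟩
  k C 1 + k C 2                      ≡⟨ nCk+nC[k+1]≡[n+1]C[k+1] k 1 ⟩
  suc k C 2                          ≤⟨ m≤m+n _ _ ⟩
  macUp 1 (suc n)                    ∎
  where
  open ≤-Reasoning
  k : ℕ
  k = largestK (suc n) 1 (suc n + 1)
n≤macUp (suc d) (suc n) = begin
  suc n                                                 ≤⟨ m≤n+m∸n (suc n) (k C suc (suc d)) ⟩
  k C suc (suc d) + (suc n ∸ k C suc (suc d))           ≤⟨ +-mono-≤ k≤ (n≤macUp d (suc n ∸ k C suc (suc d))) ⟩
  macUp (suc (suc d)) (suc n)                           ∎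
  where
  open ≤-Reasoning
  k : ℕ
  k = largestK (suc n) (suc (suc d)) (suc n + suc (suc d))
  k≤ : k C suc (suc d) ≤ suc k C suc (suc (suc d))
  k≤ = ≤-trans (m≤m+n _ _) (≤-reflexive (nCk+nC[k+1]≡[n+1]C[k+1] k (suc (suc d))))

-- By `n≤macUp` the correction `macUp r s ∸ s` is a true difference, so the leading binomial is a
-- lower bound. The search starts at 1, so `r ∸ 1` is a true predecessor.
C≤𝒞 : ∀ e m → (e + rOf (suc e) m) C rOf (suc e) m ≤ 𝒞 (suc e) m
C≤𝒞 e m = bound (rOf (suc e) m) (sOf (suc e) m) (findR-≥ (suc e) m m 1)
  where
  bound : ∀ r s → 1 ≤ r → (e + r) C r ≤ ((suc e + (r ∸ 1)) C r) + macUp r s ∸ s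
  bound (suc r) s _ = begin
    (e + suc r) C suc r                                     ≡⟨ cong (_C suc r) (+-suc e r) ⟩
    (suc e + r) C suc r                                     ≤⟨ m≤m+n _ _ ⟩
    (suc e + r) C suc r + (macUp (suc r) s ∸ s)             ≡⟨ +-∸-assoc ((suc e + r) C suc r) (n≤macUp r s) ⟨
    (suc e + r) C suc r + macUp (suc r) s ∸ s               ∎
    where open ≤-Reasoning

-- Comparison of the counts for large r

^-distribʳ-* : ∀ x y n → (x * y) ^ n ≡ x ^ n * y ^ n
^-distribʳ-* x y zero    = refl
^-distribʳ-* x y (suc n) = trans (cong (x * y *_) (^-distribʳ-* x y n)) ([m*n]*[o*p]≡[m*o]*[n*p] x y (x ^ n) (y ^ n))

-- The first summand gives `(2 + k) + r ≤ 2 * r`; the second lets one factor `r` absorb every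
-- constant in the face count.
threshold : ℕ → ℕ
threshold k = (2 + k) + suc k ! * (4 * (2 + k) * 4 ^ k)

-- For fixed `k` the face count grows like `r ^ k`, the binomial like `r ^ suc k`. The factor 2
-- reserves half of the binomial for the tall corners.
face-count-bound : ∀ k r → threshold k ≤ r →
  2 * (1 + (2 + k) * (2 * ((2 + k) + r)) ^ k) ≤ (suc k + r) C r
face-count-bound k r large = *-cancelˡ-≤ (suc k !) {{suc k !≢0}} (begin
  suc k ! * (2 * (1 + (2 + k) * t ^ k))               ≤⟨ *-monoʳ-≤ (suc k !) twice ⟩
  suc k ! * (4 * ((2 + k) * t ^ k))                   ≤⟨ *-monoʳ-≤ (suc k !) (*-monoʳ-≤ 4 (*-monoʳ-≤ (2 + k) t^k≤)) ⟩
  suc k ! * (4 * ((2 + k) * (4 ^ k * r ^ k)))         ≡⟨ regroup (suc k !) (2 + k) (4 ^ k) (r ^ k) ⟩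
  suc k ! * (4 * (2 + k) * 4 ^ k) * r ^ k             ≤⟨ *-monoˡ-≤ (r ^ k) (≤-trans (m≤n+m _ (2 + k)) large) ⟩
  r ^ suc k                                           ≤⟨ ^≤!*C (suc k) r ⟩
  suc k ! * ((suc k + r) C r)                         ∎)
  where
  open ≤-Reasoning
  t : ℕ
  t = 2 * ((2 + k) + r)

  regroup : ∀ f e p q → f * (4 * (e * (p * q))) ≡ f * (4 * e * p) * q
  regroup = solve-∀

  double : ∀ x → 2 * (x + x) ≡ 4 * x
  double = solve-∀

  t^k≤ : t ^ k ≤ 4 ^ k * r ^ k
  t^k≤ = ≤-trans (^-monoˡ-≤ k (≤-trans (*-monoʳ-≤ 2 (+-monoˡ-≤ r (≤-trans (m≤m+n (2 + k) _) large))) (≤-reflexive (double r))))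
                 (≤-reflexive (^-distribʳ-* 4 r k))

  -- The 1 for the corner of full support is absorbed by the face term, which is itself at least 1.
  twice : 2 * (1 + (2 + k) * t ^ k) ≤ 4 * ((2 + k) * t ^ k)
  twice = ≤-trans (*-monoʳ-≤ 2 (+-monoˡ-≤ _ (*-mono-≤ {1} {2 + k} (s≤s z≤n) (m^n>0 t k))))
                  (≤-reflexive (double ((2 + k) * t ^ k)))

-- With t = 2 (e + r) the absorption identity e C(e+r, r) = (e+r) C(e+r-1, r)
-- turns s t ≤ e m into 2 s < C(e+r-1, r).
relation-count-bound : ∀ k m r s → threshold k ≤ r → m < (2 + k + r) C r →
  s * (2 * ((2 + k) + r)) ≤ (2 + k) * m →
  s + (1 + (2 + k) * (2 * ((2 + k) + r)) ^ k) < (suc k + r) C r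
relation-count-bound k m r s large m< st≤ = *-cancelˡ-< 2 _ _ (begin-strict
  2 * (s + x)   ≡⟨ *-distribˡ-+ 2 s x ⟩
  2 * s + 2 * x <⟨ +-mono-<-≤ 2s<h (face-count-bound k r large) ⟩
  h + h         ≡⟨ cong (h +_) (+-identityʳ h) ⟨
  2 * h         ∎)
  where
  open ≤-Reasoning
  h x : ℕ
  h = (suc k + r) C r
  x = 1 + (2 + k) * (2 * ((2 + k) + r)) ^ k

  rearrange : ∀ e s → e * (2 * s) ≡ s * (2 * e)
  rearrange = solve-∀

  2s<h : 2 * s < h
  2s<h = *-cancelˡ-< (2 + k + r) _ _ (begin-strict
    (2 + k + r) * (2 * s)           ≡⟨ rearrange (2 + k + r) s ⟩
    s * (2 * (2 + k + r))           ≤⟨ st≤ ⟩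
    (2 + k) * m                     <⟨ *-monoʳ-< (2 + k) m< ⟩
    (2 + k) * ((2 + k + r) C r)     ≡⟨ C-absorption (suc k) r ⟩
    (2 + k + r) * h                 ∎)

-- Were `rOf (suc e) m` below `R`, then `findR-bound` and monotonicity would put `m` below
-- `(suc e + R) C R`.
rOf-large : ∀ e R m → (suc e + R) C R ≤ m → R ≤ rOf (suc e) m
rOf-large e R m M≤m = ≮⇒≥ λ r<R → <-irrefl refl
  (<-≤-trans (findR-bound e m m 1 (m≤m+n m 1)) (≤-trans (C-monoʳ-≤ (suc e) (<⇒≤ r<R)) M≤m))

theorem4p4 : ∀ (e : ℕ) → 3 ≤ e → ∃[ M ] (∀ (m : ℕ) → M ≤ m →
    ∀ (g : Vec ℕ (suc e)) → IsNumMonoidMinGens g → lookup g zero ≡ m →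
    ∀ (n : ℕ) → IsRho g n → n < 𝒞 e m)
theorem4p4 (suc zero)    (s≤s ())
theorem4p4 (suc (suc k)) _ = M , bound
  where
  e M : ℕ
  e = 2 + k
  -- By `rOf-large`, every `m` from this binomial on has `rOf e m` at least `threshold k`.
  M = (e + threshold k) C threshold k

  bound : ∀ m → M ≤ m → (g : Vec ℕ (suc e)) → IsNumMonoidMinGens g → lookup g zero ≡ m →
          ∀ n → IsRho g n → n < 𝒞 e m
  bound m M≤m (.m ∷ gs) (increasing , _) refl n (_ , least) =
    conclude (few-relations m {{>-nonZero m>0}} gs gs>0 (2 * (e + r)))
    where
    r : ℕ
    r = rOf e m

    m>0 : 0 < m
    m>0 = ≤-trans (≤-<-trans z≤n (r<C (suc k) (threshold k))) M≤m

    gs>0 : ∀ i → 1 ≤ lookup gs i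
    gs>0 i = ≤-trans (s≤s z≤n) (increasing zero (suc i) (s≤s z≤n))

    conclude : ∃[ ρs ] GeneratesKer (m ∷ gs) ρs ×
      ∃[ s ] s * (2 * (e + r)) ≤ e * m × length ρs ≤ s + (1 + e * (2 * (e + r)) ^ k) → n < 𝒞 e m
    conclude (ρs , generates , s , st≤ , len≤) = begin-strict
      n                                   ≤⟨ least ρs generates ⟩
      length ρs                           ≤⟨ len≤ ⟩
      s + (1 + e * (2 * (e + r)) ^ k)     <⟨ relation-count-bound k m r s (rOf-large (suc k) (threshold k) m M≤m)
                                               (findR-bound (suc k) m m 1 (m≤m+n m 1)) st≤ ⟩
      (suc k + r) C r                     ≤⟨ C≤𝒞 (suc k) m ⟩
      𝒞 e m                               ∎
      where open ≤-Reasoning
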